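{- For integers $n\ge 1$ and $r\ge 2$, let $M(n,r)$ denote the minimum length $m$ for which there exist $n$ sequences of length $m$ over the alphabet $\{0,1,\dots,r\}$ that are pairwise $r$-different. Then $$M(n,r)=\Omega\!\left(\frac{r}{\log r}\log n\right),$$ i.e. there is an absolute constant $a>0$ such that $M(n,r)\ge a\,\frac{r}{\log_2 r}\log_2 n$ for all integers $n\ge1$ and $r\ge 2$.
   Context: Two sequences $\vec x,\vec y$ of equal length over the alphabet $\{0\}\cup\{1,\dots,r\}$ are $r$-different if for every $z\in\{1,\dots,r\}$ there is a coordinate $i$ with $\{x_i,y_i\}=\{z,0\}$. -}

module Defs where

open import Data.Fin as Fin using (Fin; combine; remQuot)
import Data.Fin.Properties as Fin
import Data.Integer as ℤ
import Data.Integer.Properties as ℤ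
import Data.Integer.Solver as ℤ-Solver
open import Data.Nat as ℕ using (ℕ; zero; suc; z≤n; s≤s)
open import Data.Nat.Induction using (<-rec)
open import Data.Nat.Logarithm using (⌊log₂_⌋; ⌊log₂⌋-mono-≤; ⌊log₂[2^n]⌋≡n; ⌊log₂⌊n/2⌋⌋≡⌊log₂n⌋∸1)
import Data.Nat.Properties as ℕ
open import Data.Product using (∃; ∃-syntax; _×_; _,_; proj₁; proj₂)
open import Data.Rational as ℚ using (ℚ; 0ℚ; 1ℚ; mkℚ; 1/_; ∣_∣)
import Data.Rational.Properties as ℚ
open import Data.Rational.Solver using (module +-*-Solver)
import Data.Rational.Unnormalised as ℚᵘ
import Data.Rational.Unnormalised.Properties as ℚᵘ
open import Data.Sum using (_⊎_; inj₁; inj₂)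
open import Data.Vec using (Vec; []; _∷_; lookup; tabulate)
open import Data.Vec.Properties using (lookup∘tabulate)
open import Function using (_∘_)
open import Relation.Binary.PropositionalEquality
  using (_≡_; _≢_; refl; sym; trans; cong; cong₂; subst; subst₂)
open import Relation.Nullary using (Dec; yes; no; ¬?; contradiction)
open import Relation.Nullary.Decidable using (map′; _×-dec_; _⊎-dec_; _→-dec_)
open import Relation.Unary using (Decidable)

-- The alphabet {0} ∪ {1,…,r} is Fin (suc r); the nonzero letter z is
-- Fin.suc z for z : Fin r.

Seq : ℕ → ℕ → Set
Seq r m = Vec (Fin (suc r)) m

-- Since z is nonzero, {a , b} = {z , 0} says exactly that a and b are
-- z and 0 in one of the two orders.
Separates : ∀ {r} → Fin r → Fin (suc r) → Fin (suc r) → Set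
Separates z a b = (a ≡ Fin.suc z × b ≡ Fin.zero) ⊎ (a ≡ Fin.zero × b ≡ Fin.suc z)

Different : ∀ r {m} → Seq r m → Seq r m → Set
Different r x y = ∀ (z : Fin r) → ∃[ i ] Separates z (lookup x i) (lookup y i)

PairwiseDifferent : ∀ r {m n} → Vec (Seq r m) n → Set
PairwiseDifferent r xs = ∀ i j → i ≢ j → Different r (lookup xs i) (lookup xs j)

Realizable : ℕ → ℕ → ℕ → Set
Realizable n r m = ∃[ xs ] PairwiseDifferent r {m} {n} xs

private
  anyVec? : ∀ {A : Set} →
            (∀ {P : A → Set} → Decidable P → Dec (∃ P)) →
            ∀ m {P : Vec A m → Set} → Decidable P → Dec (∃ P)
  anyVec? any? zero    P? = map′ ([] ,_) (λ { ([] , p) → p }) (P? [])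
  anyVec? any? (suc m) P? =
    map′ (λ { (a , v , p) → a ∷ v , p }) (λ { (a ∷ v , p) → a , v , p })
         (any? λ a → anyVec? any? m λ v → P? (a ∷ v))

realizable? : ∀ n r → Decidable (Realizable n r)
realizable? n r m = anyVec? (anyVec? Fin.any? m) n λ xs →
  Fin.all? λ i → Fin.all? λ j → ¬? (i Fin.≟ j) →-dec
  Fin.all? λ z → Fin.any? λ k →
    ((lookup (lookup xs i) k Fin.≟ Fin.suc z) ×-dec (lookup (lookup xs j) k Fin.≟ Fin.zero))
    ⊎-dec
    ((lookup (lookup xs i) k Fin.≟ Fin.zero) ×-dec (lookup (lookup xs j) k Fin.≟ Fin.suc z))

-- Length n * r always suffices: the coordinates are the pairs (j , z), and
-- the i-th sequence has the letter z at (i , z) and 0 at (j , z) for j ≢ i.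
realizable : ∀ n r → Realizable n r (n ℕ.* r)
realizable n r = tabulate row , λ i j i≢j z → combine i z , inj₁ (own i z , other i j i≢j z)
  where
  letter : Fin n → Fin n × Fin r → Fin (suc r)
  letter i (j , z) with i Fin.≟ j
  ... | yes _ = Fin.suc z
  ... | no  _ = Fin.zero

  row : Fin n → Seq r (n ℕ.* r)
  row i = tabulate (letter i ∘ remQuot r)

  entry : ∀ i j z → lookup (lookup (tabulate row) i) (combine j z) ≡ letter i (j , z)
  entry i j z = trans (cong (λ v → lookup v (combine j z)) (lookup∘tabulate row i))
    (trans (lookup∘tabulate (letter i ∘ remQuot r) (combine j z))
           (cong (letter i) (Fin.remQuot-combine j z)))

  letter-own : ∀ i z → letter i (i , z) ≡ Fin.suc z
  letter-own i z with i Fin.≟ i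
  ... | yes _  = refl
  ... | no i≢i = contradiction refl i≢i

  letter-other : ∀ i j → i ≢ j → ∀ z → letter j (i , z) ≡ Fin.zero
  letter-other i j i≢j z with j Fin.≟ i
  ... | yes j≡i = contradiction (sym j≡i) i≢j
  ... | no _    = refl

  own : ∀ i z → lookup (lookup (tabulate row) i) (combine i z) ≡ Fin.suc z
  own i z = trans (entry i i z) (letter-own i z)

  other : ∀ i j → i ≢ j → ∀ z → lookup (lookup (tabulate row) j) (combine i z) ≡ Fin.zero
  other i j i≢j z = trans (entry j i z) (letter-other i j i≢j z)

IsLeast : (ℕ → Set) → ℕ → Set
IsLeast P m = P m × (∀ k → P k → m ℕ.≤ k)

least : ∀ {P : ℕ → Set} → Decidable P → ∀ m → P m → ∃ (IsLeast P)
least P? zero    p = zero , p , λ _ _ → z≤n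
least P? (suc m) p with P? zero
... | yes p₀ = zero , p₀ , λ _ _ → z≤n
... | no ¬p₀ with least (P? ∘ suc) m p
...   | k , pk , k-least = suc k , pk , λ
        { zero    p₀ → contradiction p₀ ¬p₀
        ; (suc l) pl → s≤s (k-least l pl) }

M : ℕ → ℕ → ℕ
M n r = proj₁ (least (realizable? n r) (n ℕ.* r) (realizable n r))

M-isLeast : ∀ n r → IsLeast (Realizable n r) (M n r)
M-isLeast n r = proj₂ (least (realizable? n r) (n ℕ.* r) (realizable n r))

Eventually : (ℕ → Set) → Set
Eventually P = ∃[ N ] ∀ k → N ℕ.≤ k → P k

Cauchy : (ℕ → ℚ) → Set
Cauchy x = ∀ ε → 0ℚ ℚ.< ε →
  ∃[ N ] ∀ i j → N ℕ.≤ i → N ℕ.≤ j → ∣ x i ℚ.- x j ∣ ℚ.≤ ε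

-- Two sequences representing the same real are not identified by _≡_; reals
-- x and y are equal when x ≤ y and y ≤ x.
record ℝ : Set where
  constructor mkℝ
  field
    seq    : ℕ → ℚ
    cauchy : Cauchy seq

open ℝ public

infix 4 _≤_

-- The ε is needed: terms of a sequence may exceed its limit.
_≤_ : ℝ → ℝ → Set
x ≤ y = ∀ ε → 0ℚ ℚ.< ε → Eventually λ k → seq x k ℚ.≤ seq y k ℚ.+ ε

-- Termwise 0 < x k is not enough: the terms must stay away from 0.
Positive : ℝ → Set
Positive x = ∃[ c ] 0ℚ ℚ.< c × Eventually λ k → c ℚ.≤ seq x k

private
  module _ where
    open +-*-Solver

    cancelˡ : ∀ q ε → (q ℚ.+ ε) ℚ.- q ≡ ε
    cancelˡ = solve 2 (λ q ε → (q :+ ε) :- q := ε) refl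

    swap-minus : ∀ p q → q ℚ.- p ≡ ℚ.- (p ℚ.- q)
    swap-minus = solve 2 (λ p q → q :- p := :- (p :- q)) refl

    add-sub : ∀ a b → a ≡ b ℚ.+ (a ℚ.- b)
    add-sub = solve 2 (λ a b → a := b :+ (a :- b)) refl

    product-diff : ∀ a b c d → a ℚ.* b ℚ.- c ℚ.* d ≡ a ℚ.* (b ℚ.- d) ℚ.+ (a ℚ.- c) ℚ.* d
    product-diff = solve 4 (λ a b c d → a :* b :- c :* d := a :* (b :- d) :+ (a :- c) :* d) refl

    collect-δ : ∀ b c e u → b ℚ.* (e ℚ.* u) ℚ.+ (e ℚ.* u) ℚ.* c ≡ e ℚ.* ((b ℚ.+ c) ℚ.* u)
    collect-δ = solve 4 (λ b c e u → b :* (e :* u) :+ (e :* u) :* c := e :* ((b :+ c) :* u)) refl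

    cross : ∀ a b s t → a ℚ.* (t ℚ.* b) ℚ.- b ℚ.* (s ℚ.* a) ≡ (a ℚ.* b) ℚ.* (t ℚ.- s)
    cross = solve 4 (λ a b s t → a :* (t :* b) :- b :* (s :* a) := (a :* b) :* (t :- s)) refl

    regroup : ∀ v a b d → ((v ℚ.* a) ℚ.* (v ℚ.* b)) ℚ.* d ≡ (v ℚ.* v) ℚ.* ((a ℚ.* b) ℚ.* d)
    regroup = solve 4 (λ v a b d → ((v :* a) :* (v :* b)) :* d := (v :* v) :* ((a :* b) :* d)) refl

    collect-c : ∀ v c e → (v ℚ.* v) ℚ.* (c ℚ.* c ℚ.* e) ≡ (v ℚ.* c) ℚ.* (v ℚ.* c) ℚ.* e
    collect-c = solve 3 (λ v c e → (v :* v) :* (c :* c :* e) := (v :* c) :* (v :* c) :* e) refl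

  opaque
    ∣-∣-bound : ∀ {p q ε} → p ℚ.≤ q ℚ.+ ε → q ℚ.≤ p ℚ.+ ε → ∣ p ℚ.- q ∣ ℚ.≤ ε
    ∣-∣-bound {p} {q} {ε} p≤ q≤ with ℚ.∣p∣≡p∨∣p∣≡-p (p ℚ.- q)
    ... | inj₁ eq = subst₂ ℚ._≤_ (sym eq)
      (cancelˡ q ε) (ℚ.+-monoˡ-≤ (ℚ.- q) p≤)
    ... | inj₂ eq = subst₂ ℚ._≤_
      (trans (swap-minus p q) (sym eq))
      (cancelˡ p ε) (ℚ.+-monoˡ-≤ (ℚ.- p) q≤)

    ∣*∣-mono : ∀ {p q a b} → ∣ p ∣ ℚ.≤ a → ∣ q ∣ ℚ.≤ b → ∣ p ℚ.* q ∣ ℚ.≤ a ℚ.* b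
    ∣*∣-mono {p} {q} {a} {b} p≤a q≤b = begin
      ∣ p ℚ.* q ∣       ≡⟨ ℚ.∣p*q∣≡∣p∣*∣q∣ p q ⟩
      ∣ p ∣ ℚ.* ∣ q ∣   ≤⟨ ℚ.*-monoʳ-≤-nonNeg ∣ q ∣ {{ℚ.∣-∣-nonNeg q}} p≤a ⟩
      a ℚ.* ∣ q ∣       ≤⟨ ℚ.*-monoˡ-≤-nonNeg a
                             {{ℚ.nonNegative (ℚ.≤-trans (ℚ.0≤∣p∣ p) p≤a)}} q≤b ⟩
      a ℚ.* b           ∎
      where open ℚ.≤-Reasoning

    0<1 : 0ℚ ℚ.< 1ℚ
    0<1 = ℚ.*<* (ℤ.+<+ (s≤s z≤n))

    upperBound : ∀ a b c d → ∃[ N ] a ℕ.≤ N × b ℕ.≤ N × c ℕ.≤ N × d ℕ.≤ N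
    upperBound a b c d = (a ℕ.+ b) ℕ.+ (c ℕ.+ d)
      , ℕ.≤-trans (ℕ.m≤m+n a b) (ℕ.m≤m+n (a ℕ.+ b) (c ℕ.+ d))
      , ℕ.≤-trans (ℕ.m≤n+m b a) (ℕ.m≤m+n (a ℕ.+ b) (c ℕ.+ d))
      , ℕ.≤-trans (ℕ.m≤m+n c d) (ℕ.m≤n+m (c ℕ.+ d) (a ℕ.+ b))
      , ℕ.≤-trans (ℕ.m≤n+m d c) (ℕ.m≤n+m (c ℕ.+ d) (a ℕ.+ b))

    product-close : ∀ a b c d {B C δ} →
      ∣ a ∣ ℚ.≤ B → ∣ d ∣ ℚ.≤ C → ∣ a ℚ.- c ∣ ℚ.≤ δ → ∣ b ℚ.- d ∣ ℚ.≤ δ →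
      ∣ a ℚ.* b ℚ.- c ℚ.* d ∣ ℚ.≤ B ℚ.* δ ℚ.+ δ ℚ.* C
    product-close a b c d {B} {C} {δ} a≤B d≤C ac≤δ bd≤δ = begin
      ∣ a ℚ.* b ℚ.- c ℚ.* d ∣
        ≡⟨ cong ∣_∣ (product-diff a b c d) ⟩
      ∣ a ℚ.* (b ℚ.- d) ℚ.+ (a ℚ.- c) ℚ.* d ∣
        ≤⟨ ℚ.∣p+q∣≤∣p∣+∣q∣ (a ℚ.* (b ℚ.- d)) ((a ℚ.- c) ℚ.* d) ⟩
      ∣ a ℚ.* (b ℚ.- d) ∣ ℚ.+ ∣ (a ℚ.- c) ℚ.* d ∣
        ≤⟨ ℚ.+-mono-≤ (∣*∣-mono {a} {b ℚ.- d} {B} {δ} a≤B bd≤δ) (∣*∣-mono {a ℚ.- c} {d} {δ} {C} ac≤δ d≤C) ⟩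
      B ℚ.* δ ℚ.+ δ ℚ.* C ∎
      where open ℚ.≤-Reasoning

    *-pos : ∀ {p q} → 0ℚ ℚ.< p → 0ℚ ℚ.< q → 0ℚ ℚ.< p ℚ.* q
    *-pos {p} {q} 0<p 0<q = subst (ℚ._< p ℚ.* q) (ℚ.*-zeroˡ q)
      (ℚ.*-monoˡ-<-pos q {{ℚ.positive 0<q}} 0<p)

    1/-pos : ∀ {p} (0<p : 0ℚ ℚ.< p) → 0ℚ ℚ.< (1/ p) {{ℚ.>-nonZero 0<p}}
    1/-pos {p} 0<p =
      ℚ.positive⁻¹ _ {{ℚ.1/pos⇒pos p {{ℚ.positive 0<p}}}}

    split-ε : ∀ {B C ε} → 0ℚ ℚ.< B → 0ℚ ℚ.< C → 0ℚ ℚ.< ε →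
      ∃[ δ ] 0ℚ ℚ.< δ × B ℚ.* δ ℚ.+ δ ℚ.* C ≡ ε
    split-ε {B} {C} {ε} 0<B 0<C 0<ε = ε ℚ.* u , *-pos 0<ε (1/-pos 0<B+C) , (begin-equality
      B ℚ.* (ε ℚ.* u) ℚ.+ (ε ℚ.* u) ℚ.* C   ≡⟨ collect-δ B C ε u ⟩
      ε ℚ.* ((B ℚ.+ C) ℚ.* u)               ≡⟨ cong (ε ℚ.*_) (ℚ.*-inverseʳ (B ℚ.+ C) {{ℚ.>-nonZero 0<B+C}}) ⟩
      ε ℚ.* 1ℚ                              ≡⟨ ℚ.*-identityʳ ε ⟩
      ε                                     ∎)
      where
      open ℚ.≤-Reasoning
      0<B+C : 0ℚ ℚ.< B ℚ.+ C
      0<B+C = ℚ.+-mono-< 0<B 0<C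
      u : ℚ
      u = (1/ (B ℚ.+ C)) {{ℚ.>-nonZero 0<B+C}}

    bounded : ∀ x → Cauchy x → ∃[ B ] 0ℚ ℚ.< B × Eventually λ k → ∣ x k ∣ ℚ.≤ B
    bounded x cx with cx 1ℚ 0<1
    ... | N , close = ∣ x N ∣ ℚ.+ 1ℚ
                    , ℚ.+-mono-≤-< (ℚ.0≤∣p∣ (x N)) 0<1
                    , N , λ k N≤k → begin
      ∣ x k ∣                        ≡⟨ cong ∣_∣ (add-sub (x k) (x N)) ⟩
      ∣ x N ℚ.+ (x k ℚ.- x N) ∣      ≤⟨ ℚ.∣p+q∣≤∣p∣+∣q∣ (x N) (x k ℚ.- x N) ⟩
      ∣ x N ∣ ℚ.+ ∣ x k ℚ.- x N ∣    ≤⟨ ℚ.+-monoʳ-≤ ∣ x N ∣ (close k N N≤k ℕ.≤-refl) ⟩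
      ∣ x N ∣ ℚ.+ 1ℚ                 ∎
      where
      open ℚ.≤-Reasoning

fromℚ : ℚ → ℝ
fromℚ q = mkℝ (λ _ → q) λ ε 0<ε → 0 , λ _ _ _ _ →
  subst (ℚ._≤ ε) (sym (cong ∣_∣ (ℚ.+-inverseʳ q))) (ℚ.<⇒≤ 0<ε)

fromℕ : ℕ → ℝ
fromℕ n = fromℚ (ℤ.+ n ℚ./ 1)

private
  opaque
    *-cauchy : ∀ x → Cauchy x → ∀ y → Cauchy y → Cauchy (λ k → x k ℚ.* y k)
    *-cauchy x cx y cy ε 0<ε with bounded x cx | bounded y cy
    ... | B , 0<B , N₁ , x≤B | C , 0<C , N₂ , y≤C with split-ε {B} {C} {ε} 0<B 0<C 0<ε
    ...   | δ , 0<δ , eq with cx δ 0<δ | cy δ 0<δ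
    ...     | N₃ , x-close | N₄ , y-close with upperBound N₁ N₂ N₃ N₄
    ...       | N , N₁≤N , N₂≤N , N₃≤N , N₄≤N = N , λ i j N≤i N≤j →
      ℚ.≤-trans
        (product-close (x i) (y i) (x j) (y j) {B} {C} {δ}
          (x≤B i (ℕ.≤-trans N₁≤N N≤i)) (y≤C j (ℕ.≤-trans N₂≤N N≤j))
          (x-close i j (ℕ.≤-trans N₃≤N N≤i) (ℕ.≤-trans N₃≤N N≤j))
          (y-close i j (ℕ.≤-trans N₄≤N N≤i) (ℕ.≤-trans N₄≤N N≤j)))
        (ℚ.≤-reflexive eq)

infixl 7 _*_

_*_ : ℝ → ℝ → ℝ
x * y = mkℝ (λ k → seq x k ℚ.* seq y k) (*-cauchy (seq x) (cauchy x) (seq y) (cauchy y))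

-- The sequence is inverted from the index on which its terms are known to
-- be at least c > 0.
inverse : (x : ℝ) → Positive x → ℝ
inverse (mkℝ x cx) (c , 0<c , N , c≤x) = mkℝ u cu
  where
  open ℚ.≤-Reasoning

  c≤ : ∀ k → c ℚ.≤ x (N ℕ.+ k)
  c≤ k = c≤x (N ℕ.+ k) (ℕ.m≤m+n N k)

  0<x : ∀ k → 0ℚ ℚ.< x (N ℕ.+ k)
  0<x k = ℚ.<-≤-trans 0<c (c≤ k)

  x≢0 : ∀ k → ℚ.NonZero (x (N ℕ.+ k))
  x≢0 k = ℚ.>-nonZero (0<x k)

  u : ℕ → ℚ
  u k = (1/ x (N ℕ.+ k)) {{x≢0 k}}

  instance
    c≢0 : ℚ.NonZero c
    c≢0 = ℚ.>-nonZero 0<c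

  xu≡1 : ∀ k → x (N ℕ.+ k) ℚ.* u k ≡ 1ℚ
  xu≡1 k = ℚ.*-inverseʳ (x (N ℕ.+ k)) {{x≢0 k}}

  u≥0 : ∀ k → 0ℚ ℚ.≤ u k
  u≥0 k = ℚ.<⇒≤ (1/-pos (0<x k))

  cu≤1 : ∀ k → c ℚ.* u k ℚ.≤ 1ℚ
  cu≤1 k = subst (c ℚ.* u k ℚ.≤_) (xu≡1 k)
    (ℚ.*-monoʳ-≤-nonNeg (u k) {{ℚ.nonNegative (u≥0 k)}} (c≤ k))

  ∣cu∣≤1 : ∀ k → ∣ c ℚ.* u k ∣ ℚ.≤ 1ℚ
  ∣cu∣≤1 k = subst (ℚ._≤ 1ℚ) (sym (ℚ.0≤p⇒∣p∣≡p 0≤cu)) (cu≤1 k)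
    where
    0≤cu : 0ℚ ℚ.≤ c ℚ.* u k
    0≤cu = ℚ.<⇒≤ (*-pos 0<c (1/-pos (0<x k)))

  1/c : ℚ
  1/c = 1/ c

  u≡ : ∀ k → 1/c ℚ.* (c ℚ.* u k) ≡ u k
  u≡ k = trans (sym (ℚ.*-assoc 1/c c (u k)))
    (trans (cong (ℚ._* u k) (ℚ.*-inverseˡ c)) (ℚ.*-identityˡ (u k)))

  opaque
    difference : ∀ i j → u i ℚ.- u j ≡
      (1/c ℚ.* 1/c) ℚ.* (((c ℚ.* u i) ℚ.* (c ℚ.* u j)) ℚ.* (x (N ℕ.+ j) ℚ.- x (N ℕ.+ i)))
    difference i j = begin-equality
      u i ℚ.- u j
        ≡⟨ cong₂ ℚ._-_ (sym (ℚ.*-identityʳ (u i))) (sym (ℚ.*-identityʳ (u j))) ⟩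
      u i ℚ.* 1ℚ ℚ.- u j ℚ.* 1ℚ
        ≡⟨ cong₂ (λ s t → u i ℚ.* s ℚ.- u j ℚ.* t) (sym (xu≡1 j)) (sym (xu≡1 i)) ⟩
      u i ℚ.* (x (N ℕ.+ j) ℚ.* u j) ℚ.- u j ℚ.* (x (N ℕ.+ i) ℚ.* u i)
        ≡⟨ cross (u i) (u j) (x (N ℕ.+ i)) (x (N ℕ.+ j)) ⟩
      (u i ℚ.* u j) ℚ.* (x (N ℕ.+ j) ℚ.- x (N ℕ.+ i))
        ≡⟨ cong₂ (λ s t → (s ℚ.* t) ℚ.* (x (N ℕ.+ j) ℚ.- x (N ℕ.+ i))) (sym (u≡ i)) (sym (u≡ j)) ⟩
      ((1/c ℚ.* (c ℚ.* u i)) ℚ.* (1/c ℚ.* (c ℚ.* u j))) ℚ.* (x (N ℕ.+ j) ℚ.- x (N ℕ.+ i))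
        ≡⟨ regroup 1/c (c ℚ.* u i) (c ℚ.* u j) (x (N ℕ.+ j) ℚ.- x (N ℕ.+ i)) ⟩
      (1/c ℚ.* 1/c) ℚ.* (((c ℚ.* u i) ℚ.* (c ℚ.* u j)) ℚ.* (x (N ℕ.+ j) ℚ.- x (N ℕ.+ i))) ∎

    0≤1/c² : 0ℚ ℚ.≤ 1/c ℚ.* 1/c
    0≤1/c² = ℚ.<⇒≤ (*-pos (1/-pos 0<c) (1/-pos 0<c))

    cu : Cauchy u
    cu ε 0<ε with cx (c ℚ.* c ℚ.* ε) (*-pos (*-pos 0<c 0<c) 0<ε)
    ... | N′ , close = N′ , λ i j N′≤i N′≤j → begin
      ∣ u i ℚ.- u j ∣
        ≡⟨ cong ∣_∣ (difference i j) ⟩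
      ∣ (1/c ℚ.* 1/c) ℚ.* (((c ℚ.* u i) ℚ.* (c ℚ.* u j)) ℚ.* (x (N ℕ.+ j) ℚ.- x (N ℕ.+ i))) ∣
        ≤⟨ ∣*∣-mono {1/c ℚ.* 1/c} {((c ℚ.* u i) ℚ.* (c ℚ.* u j)) ℚ.* (x (N ℕ.+ j) ℚ.- x (N ℕ.+ i))}
             (ℚ.≤-reflexive (ℚ.0≤p⇒∣p∣≡p 0≤1/c²))
             (∣*∣-mono {(c ℚ.* u i) ℚ.* (c ℚ.* u j)} {x (N ℕ.+ j) ℚ.- x (N ℕ.+ i)}
                (∣*∣-mono {c ℚ.* u i} {c ℚ.* u j} (∣cu∣≤1 i) (∣cu∣≤1 j))
                (close (N ℕ.+ j) (N ℕ.+ i) (ℕ.m≤n⇒m≤o+n N N′≤j) (ℕ.m≤n⇒m≤o+n N N′≤i))) ⟩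
      (1/c ℚ.* 1/c) ℚ.* (1ℚ ℚ.* (c ℚ.* c ℚ.* ε))
        ≡⟨ cong ((1/c ℚ.* 1/c) ℚ.*_) (ℚ.*-identityˡ (c ℚ.* c ℚ.* ε)) ⟩
      (1/c ℚ.* 1/c) ℚ.* (c ℚ.* c ℚ.* ε)
        ≡⟨ collect-c 1/c c ε ⟩
      (1/c ℚ.* c) ℚ.* (1/c ℚ.* c) ℚ.* ε
        ≡⟨ cong (λ s → s ℚ.* s ℚ.* ε) (ℚ.*-inverseˡ c) ⟩
      1ℚ ℚ.* 1ℚ ℚ.* ε
        ≡⟨ trans (cong (ℚ._* ε) (ℚ.*-identityˡ 1ℚ)) (ℚ.*-identityˡ ε) ⟩
      ε ∎

infixl 7 _÷_[_]

_÷_[_] : (x y : ℝ) → Positive y → ℝ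
x ÷ y [ y>0 ] = x * inverse y y>0

private
  1≤⌊log₂⌋ : ∀ {n} → 2 ℕ.≤ n → 1 ℕ.≤ ⌊log₂ n ⌋
  1≤⌊log₂⌋ = ⌊log₂⌋-mono-≤

  2*⌊n/2⌋≤n : ∀ n → 2 ℕ.* ℕ.⌊ n /2⌋ ℕ.≤ n
  2*⌊n/2⌋≤n zero          = z≤n
  2*⌊n/2⌋≤n (suc zero)    = z≤n
  2*⌊n/2⌋≤n (suc (suc n)) = subst (ℕ._≤ suc (suc n))
    (sym (ℕ.*-suc 2 ℕ.⌊ n /2⌋)) (s≤s (s≤s (2*⌊n/2⌋≤n n)))

2^⌊log₂n⌋≤n : ∀ n → 1 ℕ.≤ n → 2 ℕ.^ ⌊log₂ n ⌋ ℕ.≤ n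
2^⌊log₂n⌋≤n = <-rec _ go
  where
  open ℕ.≤-Reasoning
  go : ∀ n → (∀ {k} → k ℕ.< n → 1 ℕ.≤ k → 2 ℕ.^ ⌊log₂ k ⌋ ℕ.≤ k) → 1 ℕ.≤ n → 2 ℕ.^ ⌊log₂ n ⌋ ℕ.≤ n
  go (suc zero)        rec _ = s≤s z≤n
  go n@(suc (suc n-2)) rec _ = begin
    2 ℕ.^ ⌊log₂ n ⌋                    ≡⟨ cong (2 ℕ.^_) (sym (ℕ.m+[n∸m]≡n (1≤⌊log₂⌋ {n} (s≤s (s≤s z≤n))))) ⟩
    2 ℕ.* 2 ℕ.^ (⌊log₂ n ⌋ ℕ.∸ 1)      ≡⟨ cong (λ l → 2 ℕ.* 2 ℕ.^ l) (sym (⌊log₂⌊n/2⌋⌋≡⌊log₂n⌋∸1 n)) ⟩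
    2 ℕ.* 2 ℕ.^ ⌊log₂ ℕ.⌊ n /2⌋ ⌋      ≤⟨ ℕ.*-monoʳ-≤ 2 (rec (ℕ.⌊n/2⌋<n (suc n-2)) (s≤s z≤n)) ⟩
    2 ℕ.* ℕ.⌊ n /2⌋                    ≤⟨ 2*⌊n/2⌋≤n n ⟩
    n                                  ∎

n<2^[1+⌊log₂n⌋] : ∀ n → n ℕ.< 2 ℕ.^ suc ⌊log₂ n ⌋
n<2^[1+⌊log₂n⌋] n = ℕ.≰⇒> λ 2^≤n → ℕ.n≮n ⌊log₂ n ⌋
  (subst (ℕ._≤ ⌊log₂ n ⌋) (⌊log₂[2^n]⌋≡n (suc ⌊log₂ n ⌋)) (⌊log₂⌋-mono-≤ 2^≤n))

private
  ⌊log₂⌋-compare : ∀ n i j →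
    ⌊log₂ n ℕ.^ suc i ⌋ ℕ.* suc j ℕ.≤ suc ⌊log₂ n ℕ.^ suc j ⌋ ℕ.* suc i
  ⌊log₂⌋-compare zero        i j = z≤n
  ⌊log₂⌋-compare n@(suc n-1) i j = ℕ.≮⇒≥ λ lt → ℕ.<⇒≱ (ℕ.^-monoʳ-< 2 (s≤s (s≤s z≤n)) lt) (begin
    2 ℕ.^ (Lᵢ ℕ.* suc j)             ≡⟨ sym (ℕ.^-*-assoc 2 Lᵢ (suc j)) ⟩
    (2 ℕ.^ Lᵢ) ℕ.^ suc j             ≤⟨ ℕ.^-monoˡ-≤ (suc j) (2^⌊log₂n⌋≤n (n ℕ.^ suc i) (ℕ.m^n>0 n (suc i))) ⟩
    (n ℕ.^ suc i) ℕ.^ suc j          ≡⟨ ℕ.^-*-assoc n (suc i) (suc j) ⟩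
    n ℕ.^ (suc i ℕ.* suc j)          ≡⟨ cong (n ℕ.^_) (ℕ.*-comm (suc i) (suc j)) ⟩
    n ℕ.^ (suc j ℕ.* suc i)          ≡⟨ sym (ℕ.^-*-assoc n (suc j) (suc i)) ⟩
    (n ℕ.^ suc j) ℕ.^ suc i          ≤⟨ ℕ.^-monoˡ-≤ (suc i) (ℕ.<⇒≤ (n<2^[1+⌊log₂n⌋] (n ℕ.^ suc j))) ⟩
    (2 ℕ.^ suc Lⱼ) ℕ.^ suc i         ≡⟨ ℕ.^-*-assoc 2 (suc Lⱼ) (suc i) ⟩
    2 ℕ.^ (suc Lⱼ ℕ.* suc i)         ∎)
    where
    open ℕ.≤-Reasoning
    Lᵢ Lⱼ : ℕ
    Lᵢ = ⌊log₂ n ℕ.^ suc i ⌋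
    Lⱼ = ⌊log₂ n ℕ.^ suc j ⌋

  /-mono : ∀ a i b j → a ℕ.* suc j ℕ.≤ b ℕ.* suc i →
           ℤ.+ a ℚ./ suc i ℚ.≤ ℤ.+ b ℚ./ suc j
  /-mono a i b j le = ℚ.toℚᵘ-cancel-≤ (begin
    ℚ.toℚᵘ (ℤ.+ a ℚ./ suc i)     ≃⟨ ℚ.toℚᵘ-fromℚᵘ (ℚᵘ.mkℚᵘ (ℤ.+ a) i) ⟩
    ℚᵘ.mkℚᵘ (ℤ.+ a) i            ≤⟨ ℚᵘ.*≤* (subst₂ ℤ._≤_ (ℤ.pos-* a (suc j)) (ℤ.pos-* b (suc i)) (ℤ.+≤+ le)) ⟩
    ℚᵘ.mkℚᵘ (ℤ.+ b) j            ≃⟨ ℚᵘ.≃-sym (ℚ.toℚᵘ-fromℚᵘ (ℚᵘ.mkℚᵘ (ℤ.+ b) j)) ⟩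
    ℚ.toℚᵘ (ℤ.+ b ℚ./ suc j)     ∎)
    where open ℚᵘ.≤-Reasoning

  /-suc : ∀ b j → ℤ.+ suc b ℚ./ suc j ≡ ℤ.+ b ℚ./ suc j ℚ.+ ℤ.+ 1 ℚ./ suc j
  /-suc b j = ℚ.toℚᵘ-injective (begin
    ℚ.toℚᵘ (ℤ.+ suc b ℚ./ suc j)
      ≈⟨ ℚ.toℚᵘ-fromℚᵘ (ℚᵘ.mkℚᵘ (ℤ.+ suc b) j) ⟩
    ℚᵘ.mkℚᵘ (ℤ.+ suc b) j
      ≈⟨ ℚᵘ.*≡* (solve 2 (λ b d → (con (ℤ.+ 1) :+ b) :* (d :* d) := (b :* d :+ con (ℤ.+ 1) :* d) :* d)
                   refl (ℤ.+ b) (ℤ.+ suc j)) ⟩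
    ℚᵘ.mkℚᵘ (ℤ.+ b) j ℚᵘ.+ ℚᵘ.mkℚᵘ (ℤ.+ 1) j
      ≈⟨ ℚᵘ.≃-sym (ℚᵘ.+-cong (ℚ.toℚᵘ-fromℚᵘ (ℚᵘ.mkℚᵘ (ℤ.+ b) j)) (ℚ.toℚᵘ-fromℚᵘ (ℚᵘ.mkℚᵘ (ℤ.+ 1) j))) ⟩
    ℚ.toℚᵘ (ℤ.+ b ℚ./ suc j) ℚᵘ.+ ℚ.toℚᵘ (ℤ.+ 1 ℚ./ suc j)
      ≈⟨ ℚᵘ.≃-sym (ℚ.toℚᵘ-homo-+ (ℤ.+ b ℚ./ suc j) (ℤ.+ 1 ℚ./ suc j)) ⟩
    ℚ.toℚᵘ (ℤ.+ b ℚ./ suc j ℚ.+ ℤ.+ 1 ℚ./ suc j) ∎)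
    where
    open import Relation.Binary.Reasoning.Setoid ℚᵘ.≃-setoid
    open ℤ-Solver.+-*-Solver

  1/[1+j]≤ : ∀ ε → 0ℚ ℚ.< ε → ∀ j → ℚ.↧ₙ ε ℕ.≤ j → ℤ.+ 1 ℚ./ suc j ℚ.≤ ε
  1/[1+j]≤ (mkℚ (ℤ.+ zero)     d _) (ℚ.*<* (ℤ.+<+ ()))
  1/[1+j]≤ (mkℚ ℤ.-[1+ _ ]     d _) (ℚ.*<* ())
  1/[1+j]≤ ε@(mkℚ (ℤ.+ suc a)  d _) _ j d<j = subst (ℤ.+ 1 ℚ./ suc j ℚ.≤_) (ℚ.↥p/↧p≡p ε)
    (/-mono 1 j (suc a) d (begin
      1 ℕ.* suc d         ≡⟨ ℕ.*-identityˡ (suc d) ⟩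
      suc d               ≤⟨ d<j ⟩
      j                   ≤⟨ ℕ.n≤1+n j ⟩
      suc j               ≤⟨ ℕ.m≤m+n (suc j) (a ℕ.* suc j) ⟩
      suc a ℕ.* suc j     ∎))
    where open ℕ.≤-Reasoning

-- log₂ n is the limit of ⌊log₂ (n ^ k)⌋ / k as k → ∞, from
-- k log₂ n - 1 < ⌊log₂ (n ^ k)⌋ ≤ k log₂ n.  For n = 0, where the logarithm
-- is undefined, the value is 0, because ⌊log₂ 0 ⌋ = 0 in the library.
log₂-seq : ℕ → ℕ → ℚ
log₂-seq n k = ℤ.+ ⌊log₂ n ℕ.^ suc k ⌋ ℚ./ suc k

private
  opaque
    log₂-seq-close : ∀ n ε → 0ℚ ℚ.< ε → ∀ i j → ℚ.↧ₙ ε ℕ.≤ j →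
                     log₂-seq n i ℚ.≤ log₂-seq n j ℚ.+ ε
    log₂-seq-close n ε 0<ε i j N≤j = begin
      log₂-seq n i                        ≤⟨ /-mono Lᵢ i (suc Lⱼ) j (⌊log₂⌋-compare n i j) ⟩
      ℤ.+ suc Lⱼ ℚ./ suc j                ≡⟨ /-suc Lⱼ j ⟩
      log₂-seq n j ℚ.+ ℤ.+ 1 ℚ./ suc j    ≤⟨ ℚ.+-monoʳ-≤ (log₂-seq n j) (1/[1+j]≤ ε 0<ε j N≤j) ⟩
      log₂-seq n j ℚ.+ ε                  ∎
      where
      open ℚ.≤-Reasoning
      Lᵢ Lⱼ : ℕ
      Lᵢ = ⌊log₂ n ℕ.^ suc i ⌋
      Lⱼ = ⌊log₂ n ℕ.^ suc j ⌋

    log₂-seq-cauchy : ∀ n → Cauchy (log₂-seq n)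
    log₂-seq-cauchy n ε 0<ε = ℚ.↧ₙ ε , λ i j N≤i N≤j →
      ∣-∣-bound {log₂-seq n i} {log₂-seq n j} {ε}
        (log₂-seq-close n ε 0<ε i j N≤j) (log₂-seq-close n ε 0<ε j i N≤i)

log₂ : ℕ → ℝ
log₂ n = mkℝ (log₂-seq n) (log₂-seq-cauchy n)

opaque
  1≤log₂-seq : ∀ r → 2 ℕ.≤ r → ∀ k → 1ℚ ℚ.≤ log₂-seq r k
  1≤log₂-seq r 2≤r k = /-mono 1 0 ⌊log₂ r ℕ.^ suc k ⌋ k (subst₂ ℕ._≤_
    (trans (⌊log₂[2^n]⌋≡n (suc k)) (sym (ℕ.*-identityˡ (suc k))))
    (sym (ℕ.*-identityʳ ⌊log₂ r ℕ.^ suc k ⌋))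
    (⌊log₂⌋-mono-≤ (ℕ.^-monoˡ-≤ (suc k) 2≤r)))

log₂-positive : ∀ {r} → 2 ℕ.≤ r → Positive (log₂ r)
log₂-positive {r} 2≤r = 1ℚ , 0<1 , 0 , λ k _ → 1≤log₂-seq r 2≤r k

-- Fix a letter z.  At each coordinate draw one of r equally likely parts; a
-- word survives the first part unless its letter is 0, and the others unless
-- its letter is z.  Two words separated at z never both survive all the draws,
-- so the survival probabilities of the n words sum to at most 1.  For a single
-- word, the product over z of the survival probabilities is at least
-- r ^ (- 2 m): per coordinate it is 1 / r for a nonzero letter and
-- (1 - 1 / r) ^ r ≥ 1 / r ^ 2 for the letter 0.  Hölder's inequality combines
-- the two bounds into n ^ r ≤ r ^ (2 m).
module Submission where

open import Defs
import Algebra.Properties.CommutativeMonoid.Sum as CommutativeMonoidSum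
open import Data.Bool using (if_then_else_)
open import Data.Fin as Fin using (Fin; punchIn)
import Data.Fin.Properties as Fin
import Data.Integer as ℤ
import Data.Integer.Properties as ℤ
open import Data.List as List using (List; []; _∷_; map; filter)
import Data.List.Properties as List
open import Data.List.Relation.Unary.All as All using (All; []; _∷_)
import Data.List.Relation.Unary.All.Properties as All
open import Data.List.Relation.Unary.AllPairs as AllPairs using (AllPairs; []; _∷_)
import Data.List.Relation.Unary.AllPairs.Properties as AllPairs
open import Data.Nat as ℕ
  using (ℕ; zero; suc; _+_; _^_; _≥_; z≤n; s≤s; NonZero)
  renaming (_*_ to _·_; _≤_ to _≤ⁿ_)
open import Data.Nat.ListAction using (sum)
open import Data.Nat.Logarithm using (⌊log₂_⌋; ⌊log₂⌋-mono-≤)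
import Data.Nat.Properties as ℕ
open import Data.Nat.Tactic.RingSolver using (solve-∀)
open import Data.Product using (∃-syntax; _×_; _,_; proj₁; proj₂)
open import Data.Rational as ℚ using (ℚ; 0ℚ; 1ℚ)
import Data.Rational.Properties as ℚ
open import Data.Rational.Solver using (module +-*-Solver)
import Data.Rational.Unnormalised as ℚᵘ
import Data.Rational.Unnormalised.Properties as ℚᵘ
open import Data.Sum using (inj₁; inj₂)
open import Data.Vec using ([]; _∷_; lookup; head; tail)
open import Function using (_∘_)
open import Relation.Binary.PropositionalEquality
  using (_≡_; _≢_; refl; sym; trans; cong; cong₂; subst)
open import Relation.Nullary using (¬_; Dec; yes; no; does; ¬?; contradiction)
open import Relation.Unary using (Decidable)

open CommutativeMonoidSum ℕ.+-0-commutativeMonoid using () renaming (sum to ∑)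
open CommutativeMonoidSum ℕ.*-1-commutativeMonoid using ()
  renaming (sum to ∏; ∑-distrib-+ to ∏-distrib-·; ∑-comm to ∏-comm; sum-cong-≗ to ∏-cong; sum-remove to ∏-remove)

-- Products and powers of natural numbers.

∏-const : ∀ n c → ∏ {n} (λ _ → c) ≡ c ^ n
∏-const zero    c = refl
∏-const (suc n) c = cong (c ·_) (∏-const n c)

∏-mono-≤ : ∀ {n} {f g : Fin n → ℕ} → (∀ i → f i ≤ⁿ g i) → ∏ f ≤ⁿ ∏ g
∏-mono-≤ {zero}  f≤g = ℕ.≤-refl
∏-mono-≤ {suc n} f≤g = ℕ.*-mono-≤ (f≤g Fin.zero) (∏-mono-≤ (f≤g ∘ Fin.suc))

^-distribʳ-· : ∀ n a b → (a · b) ^ n ≡ a ^ n · b ^ n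
^-distribʳ-· zero    a b = refl
^-distribʳ-· (suc n) a b = trans (cong (a · b ·_) (^-distribʳ-· n a b))
  (interchange a b (a ^ n) (b ^ n))
  where
  interchange : ∀ a b c d → a · b · (c · d) ≡ a · c · (b · d)
  interchange = solve-∀

^-cancelˡ-≤ : ∀ b {m n} → 2 ≤ⁿ b → b ^ m ≤ⁿ b ^ n → m ≤ⁿ n
^-cancelˡ-≤ b 2≤b le = ℕ.≮⇒≥ λ n<m → ℕ.<⇒≱ (ℕ.^-monoʳ-< b 2≤b n<m) le

^-cancelʳ-≤ : ∀ {a b} n .{{_ : NonZero n}} → a ^ n ≤ⁿ b ^ n → a ≤ⁿ b
^-cancelʳ-≤ n le = ℕ.≮⇒≥ λ b<a → ℕ.<⇒≱ (ℕ.^-monoˡ-< n b<a) le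

^-comm-exponents : ∀ a m n → (a ^ m) ^ n ≡ (a ^ n) ^ m
^-comm-exponents a m n = trans (ℕ.^-*-assoc a m n)
  (trans (cong (a ^_) (ℕ.*-comm m n)) (sym (ℕ.^-*-assoc a n m)))

∏-^ : ∀ {n} (f : Fin n → ℕ) e → ∏ (λ i → f i ^ e) ≡ ∏ f ^ e
∏-^ {zero}  f e = sym (ℕ.^-zeroˡ e)
∏-^ {suc n} f e = trans (cong (f Fin.zero ^ e ·_) (∏-^ (f ∘ Fin.suc) e))
  (sym (^-distribʳ-· e (f Fin.zero) (∏ (f ∘ Fin.suc))))

-- The inequalities of Young, AM-GM and Hölder.

2xy≤x²+y² : ∀ x y → 2 · (x · y) ≤ⁿ x · x + y · y
2xy≤x²+y² x y with ℕ.≤-total x y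
... | inj₁ x≤y = subst (λ y → 2 · (x · y) ≤ⁿ x · x + y · y) (ℕ.m+[n∸m]≡n x≤y) (ordered x (y ℕ.∸ x))
  where
  expand : ∀ x d → x · x + (x + d) · (x + d) ≡ 2 · (x · (x + d)) + d · d
  expand = solve-∀
  ordered : ∀ x d → 2 · (x · (x + d)) ≤ⁿ x · x + (x + d) · (x + d)
  ordered x d = subst (2 · (x · (x + d)) ≤ⁿ_) (sym (expand x d)) (ℕ.m≤m+n _ (d · d))
... | inj₂ y≤x = subst (λ x → 2 · (x · y) ≤ⁿ x · x + y · y) (ℕ.m+[n∸m]≡n y≤x) (ordered y (x ℕ.∸ y))
  where
  expand : ∀ y d → (y + d) · (y + d) + y · y ≡ 2 · ((y + d) · y) + d · d
  expand = solve-∀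
  ordered : ∀ y d → 2 · ((y + d) · y) ≤ⁿ (y + d) · (y + d) + y · y
  ordered y d = subst (2 · ((y + d) · y) ≤ⁿ_) (sym (expand y d)) (ℕ.m≤m+n _ (d · d))

-- Induction on `n`: `y` times the hypothesis plus `suc n · x ^ n` times `2xy≤x²+y²`. The terms
-- added to both sides are those that then cancel; they replace subtraction.
young : ∀ n x y → suc n · (x ^ n · y) ≤ⁿ y ^ suc n + n · x ^ suc n
young zero    x y = ℕ.≤-reflexive (base y)
  where
  base : ∀ y → 1 · (1 · y) ≡ y · 1 + 0
  base = solve-∀
young (suc n) x y = ℕ.+-cancelʳ-≤ (n · (x · X · y) + suc n · (X · (y · y))) _ _ (begin
  suc (suc n) · (x · X · y) + (n · (x · X · y) + suc n · (X · (y · y)))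
    ≡⟨ left n x y X ⟩
  y · (suc n · (X · y)) + suc n · X · (2 · (x · y))
    ≤⟨ ℕ.+-mono-≤ (ℕ.*-monoʳ-≤ y (young n x y)) (ℕ.*-monoʳ-≤ (suc n · X) (2xy≤x²+y² x y)) ⟩
  y · (y · Y + n · (x · X)) + suc n · X · (x · x + y · y)
    ≡⟨ right n x y X Y ⟩
  y · (y · Y) + suc n · (x · (x · X)) + (n · (x · X · y) + suc n · (X · (y · y))) ∎)
  where
  open ℕ.≤-Reasoning
  X Y : ℕ
  X = x ^ n
  Y = y ^ n
  left : ∀ n x y X → suc (suc n) · (x · X · y) + (n · (x · X · y) + suc n · (X · (y · y)))
       ≡ y · (suc n · (X · y)) + suc n · X · (2 · (x · y))
  left = solve-∀
  right : ∀ n x y X Y → y · (y · Y + n · (x · X)) + suc n · X · (x · x + y · y)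
        ≡ y · (y · Y) + suc n · (x · (x · X)) + (n · (x · X · y) + suc n · (X · (y · y)))
  right = solve-∀

-- Young's inequality at the points (1 + n) s and n (a + s).
amgm-step : ∀ n .{{_ : NonZero n}} a s →
            suc n ^ suc n · (s ^ n · a) ≤ⁿ n ^ n · (a + s) ^ suc n
amgm-step n a s = ℕ.*-cancelˡ-≤ n (ℕ.+-cancelʳ-≤ (n · (suc n · A · (s · S))) _ _ (begin
  n · (suc n · A · (S · a)) + n · (suc n · A · (s · S))
    ≡⟨ left n a s A S ⟩
  suc n · (A · S · (n · (a + s)))
    ≡⟨ cong (λ p → suc n · (p · (n · (a + s)))) (^-distribʳ-· n (suc n) s) ⟨
  suc n · ((suc n · s) ^ n · (n · (a + s)))
    ≤⟨ young n (suc n · s) (n · (a + s)) ⟩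
  (n · (a + s)) ^ suc n + n · (suc n · s) ^ suc n
    ≡⟨ cong₂ (λ p q → p + n · q) (^-distribʳ-· (suc n) n (a + s)) (^-distribʳ-· (suc n) (suc n) s) ⟩
  n · n ^ n · (a + s) ^ suc n + n · (suc n · A · (s · S))
    ≡⟨ cong (_+ n · (suc n · A · (s · S))) (ℕ.*-assoc n (n ^ n) ((a + s) ^ suc n)) ⟩
  n · (n ^ n · (a + s) ^ suc n) + n · (suc n · A · (s · S)) ∎))
  where
  open ℕ.≤-Reasoning
  A S : ℕ
  A = suc n ^ n
  S = s ^ n
  left : ∀ n a s A S → n · (suc n · A · (S · a)) + n · (suc n · A · (s · S))
       ≡ suc n · (A · S · (n · (a + s)))
  left = solve-∀

-- AM-GM with denominators cleared. The extra factor `n ^ n` lets the hypothesis for the last `n`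
-- numbers apply before `amgm-step` brings in the first one. One number is a separate case because
-- `amgm-step` needs `n` nonzero.
amgm : ∀ {n} (a : Fin n → ℕ) → n ^ n · ∏ a ≤ⁿ ∑ a ^ n
amgm {zero}          a = ℕ.≤-refl
amgm {suc zero}      a = ℕ.≤-reflexive (base (a Fin.zero))
  where
  base : ∀ x → 1 · 1 · (x · 1) ≡ (x + 0) · 1
  base = solve-∀
amgm {suc n@(suc _)} a = ℕ.*-cancelˡ-≤ (n ^ n) {{ℕ.m^n≢0 n n}} (begin
  n ^ n · (suc n ^ suc n · (a₀ · ∏ a′))     ≡⟨ regroup (n ^ n) (suc n ^ suc n) a₀ (∏ a′) ⟩
  suc n ^ suc n · (n ^ n · ∏ a′ · a₀)       ≤⟨ ℕ.*-monoʳ-≤ (suc n ^ suc n) (ℕ.*-monoˡ-≤ a₀ (amgm a′)) ⟩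
  suc n ^ suc n · (∑ a′ ^ n · a₀)           ≤⟨ amgm-step n a₀ (∑ a′) ⟩
  n ^ n · (a₀ + ∑ a′) ^ suc n               ∎)
  where
  open ℕ.≤-Reasoning
  a₀ : ℕ
  a₀ = a Fin.zero
  a′ : Fin n → ℕ
  a′ = a ∘ Fin.suc
  regroup : ∀ p q x y → p · (q · (x · y)) ≡ q · (p · y · x)
  regroup = solve-∀

-- Hölder's inequality for r families of n numbers, when the n cross products
-- have a common lower bound c / d.  It is AM-GM for each family, multiplied
-- over the families, and then an n-th root.
hölder : ∀ {r n} .{{_ : NonZero n}} (a : Fin r → Fin n → ℕ) c d →
         (∀ i → c ≤ⁿ ∏ (λ z → a z i) · d) →
         n ^ r · c ≤ⁿ ∏ (λ z → ∑ (a z)) · d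
hölder {r} {n} a c d c≤ = ^-cancelʳ-≤ n (begin
  (n ^ r · c) ^ n
    ≡⟨ ^-distribʳ-· n (n ^ r) c ⟩
  (n ^ r) ^ n · c ^ n
    ≡⟨ cong₂ _·_ (trans (^-comm-exponents n r n) (sym (∏-const r (n ^ n)))) (sym (∏-const n c)) ⟩
  ∏ {r} (λ _ → n ^ n) · ∏ {n} (λ _ → c)
    ≤⟨ ℕ.*-monoʳ-≤ (∏ {r} (λ _ → n ^ n)) (∏-mono-≤ c≤) ⟩
  ∏ {r} (λ _ → n ^ n) · ∏ (λ i → ∏ (λ z → a z i) · d)
    ≡⟨ cong (∏ {r} (λ _ → n ^ n) ·_) (∏-distrib-· (λ i → ∏ (λ z → a z i)) (λ _ → d)) ⟩
  ∏ {r} (λ _ → n ^ n) · (∏ (λ i → ∏ (λ z → a z i)) · ∏ {n} (λ _ → d))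
    ≡⟨ ℕ.*-assoc (∏ {r} (λ _ → n ^ n)) _ _ ⟨
  ∏ {r} (λ _ → n ^ n) · ∏ (λ i → ∏ (λ z → a z i)) · ∏ {n} (λ _ → d)
    ≡⟨ cong₂ (λ p q → ∏ {r} (λ _ → n ^ n) · p · q) (∏-comm (λ i z → a z i)) (∏-const n d) ⟩
  ∏ {r} (λ _ → n ^ n) · ∏ (λ z → ∏ (a z)) · d ^ n
    ≡⟨ cong (_· d ^ n) (∏-distrib-· (λ _ → n ^ n) (λ z → ∏ (a z))) ⟨
  ∏ (λ z → n ^ n · ∏ (a z)) · d ^ n
    ≤⟨ ℕ.*-monoˡ-≤ (d ^ n) (∏-mono-≤ (λ z → amgm (a z))) ⟩
  ∏ (λ z → ∑ (a z) ^ n) · d ^ n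
    ≡⟨ cong (_· d ^ n) (∏-^ (λ z → ∑ (a z)) n) ⟩
  ∏ (λ z → ∑ (a z)) ^ n · d ^ n
    ≡⟨ ^-distribʳ-· n (∏ (λ z → ∑ (a z))) d ⟨
  (∏ (λ z → ∑ (a z)) · d) ^ n ∎)
  where open ℕ.≤-Reasoning

-- The estimate (1 - 1/r)^r ≥ 1/r^2.

-- Each step multiplies by 1 + 1/k, which adds (1 + j)/k to the bound 1 + j, and this is at most 1
-- because `suc j` is still at most `k`.
[1+k]^j≤[1+j]k^j : ∀ k j → j ≤ⁿ k → suc k ^ j ≤ⁿ suc j · k ^ j
[1+k]^j≤[1+j]k^j k zero    _   = ℕ.≤-refl
[1+k]^j≤[1+j]k^j k (suc j) j<k = begin
  suc k · suc k ^ j                      ≤⟨ ℕ.*-monoʳ-≤ (suc k) ([1+k]^j≤[1+j]k^j k j (ℕ.<⇒≤ j<k)) ⟩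
  suc k · (suc j · k ^ j)                ≡⟨ expand k j (k ^ j) ⟩
  suc j · k ^ j + suc j · (k · k ^ j)    ≤⟨ ℕ.+-monoˡ-≤ (suc j · (k · k ^ j)) (ℕ.*-monoˡ-≤ (k ^ j) j<k) ⟩
  suc (suc j) · (k · k ^ j)              ∎
  where
  open ℕ.≤-Reasoning
  expand : ∀ k j p → suc k · (suc j · p) ≡ suc j · p + suc j · (k · p)
  expand = solve-∀

-- With r = 1 + k this is the estimate needed for the letter 0, freed of fractions.
[1+k]^[1+k]≤k^[1+k][1+k]² : ∀ k → 1 ≤ⁿ k → suc k ^ suc k ≤ⁿ k ^ suc k · suc k ^ 2
[1+k]^[1+k]≤k^[1+k][1+k]² k 1≤k = begin
  suc k · suc k ^ k               ≤⟨ ℕ.*-monoʳ-≤ (suc k) ([1+k]^j≤[1+j]k^j k k ℕ.≤-refl) ⟩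
  suc k · (suc k · k ^ k)         ≤⟨ ℕ.*-monoʳ-≤ (suc k) (ℕ.*-monoʳ-≤ (suc k) (ℕ.m≤n*m (k ^ k) k {{ℕ.>-nonZero 1≤k}})) ⟩
  suc k · (suc k · (k · k ^ k))   ≡⟨ regroup (suc k) (k · k ^ k) ⟩
  k · k ^ k · suc k ^ 2           ∎
  where
  open ℕ.≤-Reasoning
  regroup : ∀ p q → p · (p · q) ≡ q · (p · (p · 1))
  regroup = solve-∀

-- Survival weights and their Kraft-type inequality.

indicator : ∀ {P : Set} → Dec P → ℕ
indicator P? = if does P? then 1 else 0

-- The number of ways to choose one of 1 + k parts at each coordinate, when a
-- word survives part 0 unless its letter is 0, and survives each of the k
-- other parts unless its letter is z.
letterWeight : ∀ {r} → ℕ → Fin r → Fin (suc r) → ℕ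
letterWeight k z c = indicator (¬? (c Fin.≟ Fin.zero)) + k · indicator (¬? (c Fin.≟ Fin.suc z))

weight : ∀ {r m} → ℕ → Fin r → Seq r m → ℕ
weight k z []      = 1
weight k z (c ∷ x) = letterWeight k z c · weight k z x

Separated : ∀ {r m} → Fin r → Seq r m → Seq r m → Set
Separated z x y = ∃[ i ] Separates z (lookup x i) (lookup y i)

All⇒AllPairs : ∀ {A : Set} {P : A → Set} {xs} → All P xs → AllPairs (λ x y → P x × P y) xs
All⇒AllPairs []         = []
All⇒AllPairs (px ∷ pxs) = All.map (px ,_) pxs ∷ All⇒AllPairs pxs

module _ {r m : ℕ} {P : Fin (suc r) → Set} (P? : Decidable P) where

  tails : List (Seq r (suc m)) → List (Seq r m)
  tails xs = map tail (filter (P? ∘ head) xs)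

  -- Two kept words both have heads in `P`, so the first coordinate cannot separate them; the
  -- separating coordinate lies in the tails.
  tails-separated : ∀ {z} → (∀ {a b} → P a → P b → ¬ Separates z a b) →
                    ∀ xs → AllPairs (Separated z) xs → AllPairs (Separated z) (tails xs)
  tails-separated {z} ¬sep xs sep = AllPairs.map⁺ (AllPairs.zipWith (λ {x} {y} → onTails {x} {y})
    ( All⇒AllPairs (All.all-filter (P? ∘ head) xs)
    , AllPairs.filter⁺ (P? ∘ head) sep))
    where
    onTails : ∀ {x y : Seq r (suc m)} → (P (head x) × P (head y)) × Separated z x y →
              Separated z (tail x) (tail y)
    onTails {_ ∷ _} {_ ∷ _} ((pa , pb) , Fin.zero  , s) = contradiction s (¬sep pa pb)
    onTails {_ ∷ _} {_ ∷ _} (_         , Fin.suc i , s) = i , s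

  sum-tails : ∀ (f : Seq r m → ℕ) xs →
              sum (map (λ x → indicator (P? (head x)) · f (tail x)) xs) ≡ sum (map f (tails xs))
  sum-tails f []       = refl
  sum-tails f (x ∷ xs) with P? (head x)
  ... | yes _ = cong₂ _+_ (ℕ.+-identityʳ (f (tail x))) (sum-tails f xs)
  ... | no _  = sum-tails f xs

-- Splits the count by the part drawn at the first coordinate: part 0 once, then `k` parts that let
-- the same words survive.
sum-weight : ∀ {r m} k (z : Fin r) (xs : List (Seq r (suc m))) →
  sum (map (weight k z) xs) ≡
  sum (map (λ x → indicator (¬? (head x Fin.≟ Fin.zero)) · weight k z (tail x)) xs)
  + k · sum (map (λ x → indicator (¬? (head x Fin.≟ Fin.suc z)) · weight k z (tail x)) xs)
sum-weight k z []             = sym (ℕ.*-zeroʳ k)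
sum-weight k z ((c ∷ x) ∷ xs) = trans
  (cong (letterWeight k z c · weight k z x +_) (sum-weight k z xs))
  (regroup k (indicator (¬? (c Fin.≟ Fin.zero))) (indicator (¬? (c Fin.≟ Fin.suc z))) (weight k z x) _ _)
  where
  regroup : ∀ k p q w s t → (p + k · q) · w + (s + k · t) ≡ (p · w + s) + k · (q · w + t)
  regroup = solve-∀

-- Induction on the length. Neither the words surviving part 0 nor those surviving another part can
-- be separated at their first letters, so the hypothesis applies to both lists of tails.
kraft : ∀ {r} m k (z : Fin r) (xs : List (Seq r m)) → AllPairs (Separated z) xs →
        sum (map (weight k z) xs) ≤ⁿ suc k ^ m
kraft zero    k z []            _                          = z≤n
kraft zero    k z ([] ∷ [])     _                          = ℕ.≤-refl
-- Two empty words have no coordinate at which to be separated.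
kraft zero    k z (_ ∷ _ ∷ _)   (((() , _) ∷ _) ∷ _)
kraft (suc m) k z xs sep = begin
  sum (map (weight k z) xs)
    ≡⟨ sum-weight k z xs ⟩
  _ ≡⟨ cong₂ (λ s t → s + k · t) (sum-tails ≢0? (weight k z) xs) (sum-tails ≢z? (weight k z) xs) ⟩
  sum (map (weight k z) (tails ≢0? xs)) + k · sum (map (weight k z) (tails ≢z? xs))
    ≤⟨ ℕ.+-mono-≤ (kraft m k z (tails ≢0? xs) (tails-separated ≢0? ¬sep₀ xs sep))
        (ℕ.*-monoʳ-≤ k (kraft m k z (tails ≢z? xs) (tails-separated ≢z? ¬sep₁ xs sep))) ⟩
  suc k · suc k ^ m ∎
  where
  open ℕ.≤-Reasoning
  ≢0? : Decidable (_≢ Fin.zero)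
  ≢0? c = ¬? (c Fin.≟ Fin.zero)
  ≢z? : Decidable (_≢ Fin.suc z)
  ≢z? c = ¬? (c Fin.≟ Fin.suc z)
  ¬sep₀ : ∀ {a b} → a ≢ Fin.zero → b ≢ Fin.zero → ¬ Separates z a b
  ¬sep₀ a≢ b≢ (inj₁ (_ , b≡)) = b≢ b≡
  ¬sep₀ a≢ b≢ (inj₂ (a≡ , _)) = a≢ a≡
  ¬sep₁ : ∀ {a b} → a ≢ Fin.suc z → b ≢ Fin.suc z → ¬ Separates z a b
  ¬sep₁ a≢ b≢ (inj₁ (a≡ , _)) = a≢ a≡
  ¬sep₁ a≢ b≢ (inj₂ (_ , b≡)) = b≢ b≡

sum-tabulate : ∀ {n} (f : Fin n → ℕ) → sum (List.tabulate f) ≡ ∑ f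
sum-tabulate {zero}  f = refl
sum-tabulate {suc n} f = cong (f Fin.zero +_) (sum-tabulate (f ∘ Fin.suc))

-- Returns from lists, which `kraft` uses because filtering changes the number of words, to families
-- indexed by `Fin n`.
∑-weight≤ : ∀ {r m n} k (z : Fin r) (x : Fin n → Seq r m) →
            (∀ i j → i ≢ j → Separated z (x i) (x j)) → ∑ (weight k z ∘ x) ≤ⁿ suc k ^ m
∑-weight≤ {m = m} k z x sep = subst (_≤ⁿ suc k ^ m)
  (trans (cong sum (List.map-tabulate x (weight k z))) (sum-tabulate (weight k z ∘ x)))
  (kraft m k z (List.tabulate x) (AllPairs.tabulate⁺ (λ {i} {j} → sep i j)))

-- Lower bound for the product of the weights over all letters.

letterWeight-zero : ∀ {r} k (z : Fin r) → letterWeight k z Fin.zero ≡ k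
letterWeight-zero k z = ℕ.*-identityʳ k

letterWeight-own : ∀ {r} k (y : Fin r) → letterWeight k y (Fin.suc y) ≡ 1
letterWeight-own k y with y Fin.≟ y
... | yes _   = cong suc (ℕ.*-zeroʳ k)
... | no y≢y  = contradiction refl y≢y

letterWeight-other : ∀ {r} k (y z : Fin r) → z ≢ y → letterWeight k z (Fin.suc y) ≡ suc k
letterWeight-other k y z z≢y with y Fin.≟ z
... | yes y≡z = contradiction (sym y≡z) z≢y
... | no _    = cong suc (ℕ.*-identityʳ k)

∏-letterWeight≥ : ∀ k → 1 ≤ⁿ k → (c : Fin (suc (suc k))) →
                  suc k ^ suc k ≤ⁿ ∏ {suc k} (λ z → letterWeight k z c) · suc k ^ 2
∏-letterWeight≥ k 1≤k Fin.zero = subst (λ p → suc k ^ suc k ≤ⁿ p · suc k ^ 2)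
  (sym (trans (∏-cong (letterWeight-zero {suc k} k)) (∏-const (suc k) k)))
  ([1+k]^[1+k]≤k^[1+k][1+k]² k 1≤k)
∏-letterWeight≥ k _ (Fin.suc y) = begin
  -- A nonzero letter loses only one factor `suc k`; the second is given away to match the bound for
  -- the letter 0.
  suc k · suc k ^ k                              ≤⟨ ℕ.m≤m*n _ (suc k) ⟩
  suc k · suc k ^ k · suc k                      ≡⟨ regroup (suc k) (suc k ^ k) ⟩
  1 · suc k ^ k · suc k ^ 2                      ≡⟨ cong₂ (λ p q → p · q · suc k ^ 2) own others ⟨
  w y · ∏ (w ∘ punchIn y) · suc k ^ 2            ≡⟨ cong (_· suc k ^ 2) (∏-remove {i = y} w) ⟨
  ∏ w · suc k ^ 2                                ∎
  where
  open ℕ.≤-Reasoning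
  w : Fin (suc k) → ℕ
  w z = letterWeight k z (Fin.suc y)
  own : w y ≡ 1
  own = letterWeight-own k y
  others : ∏ (w ∘ punchIn y) ≡ suc k ^ k
  others = trans (∏-cong λ j → letterWeight-other k y (punchIn y j) (Fin.punchInᵢ≢i y j)) (∏-const k (suc k))
  regroup : ∀ p q → p · q · p ≡ 1 · q · (p · (p · 1))
  regroup = solve-∀

∏-weight≥ : ∀ {m} k → 1 ≤ⁿ k → (x : Seq (suc k) m) →
            (suc k ^ suc k) ^ m ≤ⁿ ∏ (λ z → weight k z x) · (suc k ^ 2) ^ m
∏-weight≥         k 1≤k []      = ℕ.≤-reflexive (sym (trans (cong (_· 1) (∏-const (suc k) 1))
  (cong (_· 1) (ℕ.^-zeroˡ (suc k)))))
∏-weight≥ {suc m} k 1≤k (c ∷ x) = begin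
  suc k ^ suc k · (suc k ^ suc k) ^ m
    ≤⟨ ℕ.*-mono-≤ (∏-letterWeight≥ k 1≤k c) (∏-weight≥ k 1≤k x) ⟩
  ∏ (λ z → letterWeight k z c) · suc k ^ 2 · (∏ (λ z → weight k z x) · (suc k ^ 2) ^ m)
    ≡⟨ interchange (∏ (λ z → letterWeight k z c)) (suc k ^ 2) (∏ (λ z → weight k z x)) ((suc k ^ 2) ^ m) ⟩
  ∏ (λ z → letterWeight k z c) · ∏ (λ z → weight k z x) · (suc k ^ 2) ^ suc m
    ≡⟨ cong (_· (suc k ^ 2) ^ suc m) (∏-distrib-· (λ z → letterWeight k z c) (λ z → weight k z x)) ⟨
  ∏ (λ z → weight k z (c ∷ x)) · (suc k ^ 2) ^ suc m ∎
  where
  open ℕ.≤-Reasoning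
  interchange : ∀ p q s t → p · q · (s · t) ≡ p · s · (q · t)
  interchange = solve-∀

-- The bound on n^r and its logarithmic form.

realizable⇒n^r≤r^2m : ∀ {n r m} → 1 ≤ⁿ n → 2 ≤ⁿ r → Realizable n r m → n ^ r ≤ⁿ (r ^ 2) ^ m
realizable⇒n^r≤r^2m {n} {r@(suc k)} {m} 1≤n (s≤s 1≤k) (xs , different) =
  -- The cancelled factor `(r ^ r) ^ m` counts the choices of parts for all `r` letters together.
  -- Hölder produces it on the left, and the `r` Kraft bounds `r ^ m` multiply to it on the right.
  ℕ.*-cancelʳ-≤ (n ^ r) ((r ^ 2) ^ m) ((r ^ r) ^ m) {{ℕ.m^n≢0 (r ^ r) m {{ℕ.m^n≢0 r r}}}} (begin
  n ^ r · (r ^ r) ^ m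
    ≤⟨ hölder {{ℕ.>-nonZero 1≤n}} (λ z i → weight k z (lookup xs i)) ((r ^ r) ^ m) ((r ^ 2) ^ m)
         (λ i → ∏-weight≥ k 1≤k (lookup xs i)) ⟩
  ∏ (λ z → ∑ (λ i → weight k z (lookup xs i))) · (r ^ 2) ^ m
    ≤⟨ ℕ.*-monoˡ-≤ ((r ^ 2) ^ m) (∏-mono-≤ λ z →
         ∑-weight≤ k z (lookup xs) (λ i j i≢j → different i j i≢j z)) ⟩
  ∏ {r} (λ _ → r ^ m) · (r ^ 2) ^ m
    ≡⟨ cong (_· (r ^ 2) ^ m) (trans (∏-const r (r ^ m)) (^-comm-exponents r m r)) ⟩
  (r ^ r) ^ m · (r ^ 2) ^ m
    ≡⟨ ℕ.*-comm ((r ^ r) ^ m) ((r ^ 2) ^ m) ⟩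
  (r ^ 2) ^ m · (r ^ r) ^ m ∎)
  where open ℕ.≤-Reasoning

-- Raising the hypothesis to the power `K` makes the rounded logarithms those in the sequences
-- defining `log₂ n` and `log₂ r`, so the real inequality can be proved term by term.
⌊log₂⌋-bound : ∀ {n r m} K .{{_ : NonZero K}} → 1 ≤ⁿ n → 2 ≤ⁿ r → n ^ r ≤ⁿ (r ^ 2) ^ m →
               r · ⌊log₂ n ^ K ⌋ ≤ⁿ 4 · (m · ⌊log₂ r ^ K ⌋)
⌊log₂⌋-bound {n} {r} {m} K 1≤n 2≤r le = ^-cancelˡ-≤ 2 ℕ.≤-refl (begin
  2 ^ (r · ln)             ≡⟨ cong (2 ^_) (ℕ.*-comm r ln) ⟩
  2 ^ (ln · r)             ≡⟨ ℕ.^-*-assoc 2 ln r ⟨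
  (2 ^ ln) ^ r             ≤⟨ ℕ.^-monoˡ-≤ r (2^⌊log₂n⌋≤n (n ^ K) (ℕ.m^n>0 n {{ℕ.>-nonZero 1≤n}} K)) ⟩
  (n ^ K) ^ r              ≡⟨ ^-comm-exponents n K r ⟩
  (n ^ r) ^ K              ≤⟨ ℕ.^-monoˡ-≤ K le ⟩
  ((r ^ 2) ^ m) ^ K        ≡⟨ cong (_^ K) (ℕ.^-*-assoc r 2 m) ⟩
  (r ^ (2 · m)) ^ K        ≡⟨ ^-comm-exponents r (2 · m) K ⟩
  (r ^ K) ^ (2 · m)        ≤⟨ ℕ.^-monoˡ-≤ (2 · m) (ℕ.<⇒≤ (n<2^[1+⌊log₂n⌋] (r ^ K))) ⟩
  (2 ^ suc lr) ^ (2 · m)   ≡⟨ ℕ.^-*-assoc 2 (suc lr) (2 · m) ⟩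
  -- Rounding up costs a factor of at most 2, since `lr` is at least 1 for `r ≥ 2`. With the
  -- exponent `2 · m` this gives the constant 4.
  2 ^ (suc lr · (2 · m))   ≤⟨ ℕ.^-monoʳ-≤ 2 (ℕ.*-monoˡ-≤ (2 · m) (ℕ.+-monoˡ-≤ lr 1≤lr)) ⟩
  2 ^ ((lr + lr) · (2 · m)) ≡⟨ cong (2 ^_) (double lr m) ⟩
  2 ^ (4 · (m · lr))       ∎)
  where
  open ℕ.≤-Reasoning
  ln lr : ℕ
  ln = ⌊log₂ n ^ K ⌋
  lr = ⌊log₂ r ^ K ⌋
  r≤r^K : ∀ K .{{_ : NonZero K}} → r ≤ⁿ r ^ K
  r≤r^K (suc K) = ℕ.m≤m*n r (r ^ K) {{ℕ.m^n≢0 r K {{ℕ.>-nonZero (ℕ.<⇒≤ 2≤r)}}}}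
  1≤lr : 1 ≤ⁿ lr
  1≤lr = ⌊log₂⌋-mono-≤ (ℕ.≤-trans 2≤r (r≤r^K K))
  double : ∀ l m → (l + l) · (2 · m) ≡ 4 · (m · l)
  double = solve-∀

-- Passage to rational and real numbers.

/-*-/ : ∀ a i b j → (ℤ.+ a ℚ./ suc i) ℚ.* (ℤ.+ b ℚ./ suc j) ≡ ℤ.+ (a · b) ℚ./ (suc i · suc j)
/-*-/ a i b j = ℚ.toℚᵘ-injective (begin
  ℚ.toℚᵘ ((ℤ.+ a ℚ./ suc i) ℚ.* (ℤ.+ b ℚ./ suc j))
    ≈⟨ ℚ.toℚᵘ-homo-* (ℤ.+ a ℚ./ suc i) (ℤ.+ b ℚ./ suc j) ⟩
  ℚ.toℚᵘ (ℤ.+ a ℚ./ suc i) ℚᵘ.* ℚ.toℚᵘ (ℤ.+ b ℚ./ suc j)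
    ≈⟨ ℚᵘ.*-cong (ℚ.toℚᵘ-fromℚᵘ (ℚᵘ.mkℚᵘ (ℤ.+ a) i)) (ℚ.toℚᵘ-fromℚᵘ (ℚᵘ.mkℚᵘ (ℤ.+ b) j)) ⟩
  ℚᵘ.mkℚᵘ (ℤ.+ a ℤ.* ℤ.+ b) (j + i · suc j)
    ≡⟨ cong (λ p → ℚᵘ.mkℚᵘ p (j + i · suc j)) (ℤ.pos-* a b) ⟨
  ℚᵘ.mkℚᵘ (ℤ.+ (a · b)) (j + i · suc j)
    ≈⟨ ℚ.toℚᵘ-fromℚᵘ (ℚᵘ.mkℚᵘ (ℤ.+ (a · b)) (j + i · suc j)) ⟨
  ℚ.toℚᵘ (ℤ.+ (a · b) ℚ./ (suc i · suc j)) ∎)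
  where open import Relation.Binary.Reasoning.Setoid ℚᵘ.≃-setoid

/1-mono-≤ : ∀ {a b} → a ≤ⁿ b → ℤ.+ a ℚ./ 1 ℚ.≤ ℤ.+ b ℚ./ 1
/1-mono-≤ {a} {b} a≤b = ℚ.toℚᵘ-cancel-≤ (begin
  ℚ.toℚᵘ (ℤ.+ a ℚ./ 1)   ≃⟨ ℚ.toℚᵘ-fromℚᵘ (ℚᵘ.mkℚᵘ (ℤ.+ a) 0) ⟩
  ℚᵘ.mkℚᵘ (ℤ.+ a) 0      ≤⟨ ℚᵘ.*≤* (ℤ.*-monoʳ-≤-nonNeg (ℤ.+ 1) (ℤ.+≤+ a≤b)) ⟩
  ℚᵘ.mkℚᵘ (ℤ.+ b) 0      ≃⟨ ℚ.toℚᵘ-fromℚᵘ (ℚᵘ.mkℚᵘ (ℤ.+ b) 0) ⟨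
  ℚ.toℚᵘ (ℤ.+ b ℚ./ 1)   ∎)
  where open ℚᵘ.≤-Reasoning

/-as-* : ∀ a k → ℤ.+ a ℚ./ suc k ≡ (ℤ.+ a ℚ./ 1) ℚ.* (ℤ.+ 1 ℚ./ suc k)
/-as-* a k = sym (trans (/-*-/ a 0 1 k)
  (ℚ./-cong (cong ℤ.+_ (ℕ.*-identityʳ a)) (ℕ.*-identityˡ (suc k))))

¼ : ℚ
¼ = ℤ.+ 1 ℚ./ 4

-- Here `u` is the reciprocal of a term of `log₂ r`. Both logarithms have denominator `suc k`, so
-- `bound` scaled by `¼`, 1/(1 + k) and `u` gives the claim: the 4 meets `¼` and the logarithm of
-- `r` meets `u`.
ratio-bound : ∀ k {r m ln lr} u → r · ln ≤ⁿ 4 · (m · lr) → 0ℚ ℚ.≤ u →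
              (ℤ.+ lr ℚ./ suc k) ℚ.* u ≡ 1ℚ →
              ¼ ℚ.* ((ℤ.+ r ℚ./ 1) ℚ.* u) ℚ.* (ℤ.+ ln ℚ./ suc k) ℚ.≤ ℤ.+ m ℚ./ 1
ratio-bound k {r} {m} {ln} {lr} u bound 0≤u inv = begin
  ¼ ℚ.* (ι r ℚ.* u) ℚ.* (ℤ.+ ln ℚ./ suc k)     ≡⟨ cong (¼ ℚ.* (ι r ℚ.* u) ℚ.*_) (/-as-* ln k) ⟩
  ¼ ℚ.* (ι r ℚ.* u) ℚ.* (ι ln ℚ.* κ)           ≡⟨ left ¼ (ι r) u (ι ln) κ ⟩
  (ι r ℚ.* ι ln) ℚ.* ¼ ℚ.* κ ℚ.* u             ≡⟨ cong (λ p → p ℚ.* ¼ ℚ.* κ ℚ.* u) (/-*-/ r 0 ln 0) ⟩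
  ι (r · ln) ℚ.* ¼ ℚ.* κ ℚ.* u                 ≤⟨ scale (/1-mono-≤ bound) ⟩
  ι (4 · (m · lr)) ℚ.* ¼ ℚ.* κ ℚ.* u           ≡⟨ cong (λ p → p ℚ.* ¼ ℚ.* κ ℚ.* u) product ⟨
  ι 4 ℚ.* (ι m ℚ.* ι lr) ℚ.* ¼ ℚ.* κ ℚ.* u     ≡⟨ right (ι 4) (ι m) (ι lr) ¼ κ u ⟩
  (ι 4 ℚ.* ¼) ℚ.* (ι m ℚ.* (ι lr ℚ.* κ ℚ.* u)) ≡⟨ cong (λ p → (ι 4 ℚ.* ¼) ℚ.* (ι m ℚ.* (p ℚ.* u))) (/-as-* lr k) ⟨
  (ι 4 ℚ.* ¼) ℚ.* (ι m ℚ.* ((ℤ.+ lr ℚ./ suc k) ℚ.* u)) ≡⟨ cong (λ p → (ι 4 ℚ.* ¼) ℚ.* (ι m ℚ.* p)) inv ⟩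
  1ℚ ℚ.* (ι m ℚ.* 1ℚ)                          ≡⟨ trans (ℚ.*-identityˡ _) (ℚ.*-identityʳ (ι m)) ⟩
  ι m                                          ∎
  where
  open ℚ.≤-Reasoning
  ι : ℕ → ℚ
  ι a = ℤ.+ a ℚ./ 1
  κ : ℚ
  κ = ℤ.+ 1 ℚ./ suc k
  scale : ∀ {p q} → p ℚ.≤ q → p ℚ.* ¼ ℚ.* κ ℚ.* u ℚ.≤ q ℚ.* ¼ ℚ.* κ ℚ.* u
  scale p≤q = ℚ.*-monoʳ-≤-nonNeg u {{ℚ.nonNegative 0≤u}}
    (ℚ.*-monoʳ-≤-nonNeg κ {{ℚ.normalize-nonNeg 1 (suc k)}} (ℚ.*-monoʳ-≤-nonNeg ¼ p≤q))
  product : ι 4 ℚ.* (ι m ℚ.* ι lr) ≡ ι (4 · (m · lr))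
  product = trans (cong (ι 4 ℚ.*_) (/-*-/ m 0 lr 0)) (/-*-/ 4 0 (m · lr) 0)
  open +-*-Solver
  left : ∀ q r u l κ → q ℚ.* (r ℚ.* u) ℚ.* (l ℚ.* κ) ≡ (r ℚ.* l) ℚ.* q ℚ.* κ ℚ.* u
  left = solve 5 (λ q r u l κ → q :* (r :* u) :* (l :* κ) := (r :* l) :* q :* κ :* u) refl
  right : ∀ f m l q κ u → f ℚ.* (m ℚ.* l) ℚ.* q ℚ.* κ ℚ.* u ≡ (f ℚ.* q) ℚ.* (m ℚ.* (l ℚ.* κ ℚ.* u))
  right = solve 6 (λ f m l q κ u → f :* (m :* l) :* q :* κ :* u := (f :* q) :* (m :* (l :* κ :* u))) refl

theorem3p6 : ∃[ a ] Positive a ×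
    (∀ (n r : ℕ) → n ≥ 1 → (r≥2 : r ≥ 2) →
    a * (fromℕ r ÷ log₂ r [ log₂-positive r≥2 ]) * log₂ n ≤ fromℕ (M n r))
theorem3p6 = fromℚ ¼ , (¼ , ℚ.positive⁻¹ ¼ , 0 , λ _ _ → ℚ.≤-refl) , bound
  where
  bound : ∀ n r → n ≥ 1 → (r≥2 : r ≥ 2) →
          fromℚ ¼ * (fromℕ r ÷ log₂ r [ log₂-positive r≥2 ]) * log₂ n ≤ fromℕ (M n r)
  -- The inequality holds at every index without `ε`, hence the threshold 0.
  bound n r n≥1 r≥2 ε 0<ε = 0 , λ k _ → ℚ.≤-trans
    (ratio-bound k {r} {M n r} (seq (inverse (log₂ r) (log₂-positive r≥2)) k)
      (⌊log₂⌋-bound {n} {r} {M n r} (suc k) n≥1 r≥2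
        (realizable⇒n^r≤r^2m n≥1 r≥2 (proj₁ (M-isLeast n r))))
      (ℚ.<⇒≤ (ℚ.positive⁻¹ _ {{ℚ.1/pos⇒pos (log₂-seq r k) {{R-pos k}}}}))
      -- Since `log₂-positive` has starting index 0, `inverse` shifts nothing, and its term `k` is
      -- exactly the reciprocal of `log₂-seq r k`.
      (ℚ.*-inverseʳ (log₂-seq r k) {{ℚ.pos⇒nonZero (log₂-seq r k) {{R-pos k}}}}))
    (subst (ℚ._≤ (ℤ.+ M n r ℚ./ 1) ℚ.+ ε) (ℚ.+-identityʳ _)
      (ℚ.+-monoʳ-≤ (ℤ.+ M n r ℚ./ 1) (ℚ.<⇒≤ 0<ε)))
    where
    R-pos : ∀ k → ℚ.Positive (log₂-seq r k)
    R-pos k = ℚ.positive (ℚ.<-≤-trans (ℚ.positive⁻¹ 1ℚ) (1≤log₂-seq r r≥2 k))
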